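{- Let $m\geqslant 0$ be an integer, let $\alpha=(\mathcal{F}_{m+i})_{i\geqslant 0}$, and let $\tilde{\alpha}=(\tilde{\alpha}_i)_{i\geqslant 0}$ with $\tilde{\alpha}_i=(-1)^i\alpha_i$. Then for all integers $n\geqslant 0$, $$\det T_{\tilde{\alpha},\alpha}(n)=\mathcal{L}_m^{\,n-1}\mathcal{F}_{2m+n}=(\mathcal{F}_{m-1}+\mathcal{F}_{m+1})^{n-1}\mathcal{F}_{2m+n}.$$ In particular: (1) if $m=0$, then $\det T_{\tilde{\mathcal{F}},\mathcal{F}}(n)=2^{n-1}\mathcal{F}_n$, where $\mathcal{F}=(\mathcal{F}_i)_{i\geqslant 0}$ and $\tilde{\mathcal{F}}=((-1)^i\mathcal{F}_i)_{i\geqslant 0}$; (2) if $m=1$, then $\det T_{\tilde{\alpha},\alpha}(n)=\mathcal{F}_{n+2}$.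
   Context: $\mathcal{F}_n$ is the $n$th Fibonacci number: $\mathcal{F}_0=0$, $\mathcal{F}_1=1$, $\mathcal{F}_n=\mathcal{F}_{n-1}+\mathcal{F}_{n-2}$ for $n\geqslant 2$, with the convention $\mathcal{F}_{ -1}=1$. $\mathcal{L}_n$ is the $n$th Lucas number: $\mathcal{L}_0=2$, $\mathcal{L}_1=1$, $\mathcal{L}_n=\mathcal{L}_{n-1}+\mathcal{L}_{n-2}$ for $n\geqslant 2$. For sequences $\alpha,\beta$ with $\alpha_0=\beta_0$, $T_{\alpha,\beta}(n)=[T_{i,j}]_{0\leqslant i,j\leqslant n}$ is the Toeplitz matrix of order $n+1$ with first column $T_{i,0}=\alpha_i$ and first row $T_{0,i}=\beta_i$ ($0\leqslant i\leqslant n$), and $T_{i,j}=T_{k,l}$ whenever $i-j=k-l$. For $n=0$ the exponent $n-1$ equals $-1$, and the formulas are identities of rational numbers. -}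

module Defs where

open import Algebra.Bundles.Raw using (RawRing)
import Algebra.Definitions.RawSemiring as RawSemiringDefs
open import Data.Fin.Base using (Fin; zero; suc; toℕ; punchIn)
open import Data.Integer.Base as ℤ using (ℤ; +_; -[1+_])
open import Data.Nat.Base as ℕ using (ℕ; zero; suc)
open import Data.Rational.Base as ℚ using (ℚ)
open import Data.Rational.Literals using (fromℤ)

𝓕 : ℕ → ℕ
𝓕 0             = 0
𝓕 1             = 1
𝓕 (suc (suc n)) = 𝓕 (suc n) ℕ.+ 𝓕 n

-- 𝓕-pred n is 𝓕ₙ₋₁, with the convention 𝓕₋₁ = 1.
𝓕-pred : ℕ → ℕ
𝓕-pred zero    = 1
𝓕-pred (suc n) = 𝓕 n

𝓛 : ℕ → ℕ
𝓛 0             = 2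
𝓛 1             = 1
𝓛 (suc (suc n)) = 𝓛 (suc n) ℕ.+ 𝓛 n

Matrix : ∀ {a} → Set a → ℕ → Set a
Matrix A n = Fin n → Fin n → A

module _ {a} {A : Set a} where

  -- α is the first column and β the first row.  The two are meant to agree
  -- at index 0; the corner entry is read from α.
  toeplitzEntry : (α β : ℕ → A) → ℕ → ℕ → A
  toeplitzEntry α β i       zero    = α i
  toeplitzEntry α β zero    (suc j) = β (suc j)
  toeplitzEntry α β (suc i) (suc j) = toeplitzEntry α β i j

  -- The rows and columns are indexed by 0, …, n, so the order is n + 1.
  toeplitz : (α β : ℕ → A) (n : ℕ) → Matrix A (suc n)
  toeplitz α β n i j = toeplitzEntry α β (toℕ i) (toℕ j)

  minor : ∀ {n} → Matrix A (suc n) → Fin (suc n) → Fin (suc n) → Matrix A n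
  minor M i j k l = M (punchIn i k) (punchIn j l)

module Determinant {c ℓ} (R : RawRing c ℓ) where

  open RawRing R
  open RawSemiringDefs rawSemiring using (sum; _^_)

  alternate : (ℕ → Carrier) → (ℕ → Carrier)
  alternate α i = (- 1#) ^ i * α i

  -- Laplace expansion along the first row.
  det : ∀ {n} → Matrix Carrier n → Carrier
  det {zero}  M = 1#
  det {suc n} M =
    sum λ j → (- 1#) ^ toℕ j * (M zero j * det (minor M zero j))

open Determinant ℚ.+-*-rawRing public
open RawSemiringDefs ℚ.+-*-rawSemiring using (_^_)

infix 9 ↑_

↑_ : ℕ → ℚ
↑ n = fromℤ (+ n)

infixr 8 _^ᶻ_

_^ᶻ_ : (p : ℚ) → ℤ → .{{ℚ.NonZero p}} → ℚ
p ^ᶻ (+ n)    = p ^ n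
p ^ᶻ -[1+ n ] = (ℚ.1/ p) ^ suc n

private
  +-nonZeroˡ : ∀ m n → .{{ℕ.NonZero m}} → ℕ.NonZero (m ℕ.+ n)
  +-nonZeroˡ (suc m) n = _

𝓛-nonZero : ∀ n → ℕ.NonZero (𝓛 n)
𝓛-nonZero 0             = _
𝓛-nonZero 1             = _
𝓛-nonZero (suc (suc n)) = +-nonZeroˡ (𝓛 (suc n)) (𝓛 n) {{𝓛-nonZero (suc n)}}

𝓕-suc-nonZero : ∀ n → ℕ.NonZero (𝓕 (suc n))
𝓕-suc-nonZero zero    = _
𝓕-suc-nonZero (suc n) = +-nonZeroˡ (𝓕 (suc n)) (𝓕 n) {{𝓕-suc-nonZero n}}

𝓕-pred+𝓕-suc-nonZero : ∀ n → ℕ.NonZero (𝓕-pred n ℕ.+ 𝓕 (suc n))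
𝓕-pred+𝓕-suc-nonZero zero          = _
𝓕-pred+𝓕-suc-nonZero (suc zero)    = _
𝓕-pred+𝓕-suc-nonZero (suc (suc n)) =
  +-nonZeroˡ (𝓕 (suc n)) (𝓕 (3 ℕ.+ n)) {{𝓕-suc-nonZero n}}

{-# OPTIONS --safe #-}

-- The diagonals of T form a bi-infinite sequence b with bₖ = 𝓕ₘ₊ₖ and b₋ₖ = (− 1)ᵏ 𝓕ₘ₊ₖ
-- for k ≥ 0.  It satisfies b₍ₖ₊₂₎ = b₍ₖ₊₁₎ + bₖ for all k ≠ − 1, and for k = − 1 it misses
-- it by b₁ − b₀ − b₋₁ = 2 𝓕ₘ₊₁ − 𝓕ₘ = 𝓛ₘ.  Subtracting from each column the two preceding
-- ones therefore leaves the first two columns, followed by columns with the single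
-- nonzero entry 𝓛ₘ, just above the diagonal.  Expanding along the first row then gives
-- 𝓛ₘⁿ⁻¹ (𝓕ₘ 𝓕ₘ₊ₙ₋₁ + 𝓕ₘ₊₁ 𝓕ₘ₊ₙ), and the bracket is 𝓕₂ₘ₊ₙ.  For n = 0 the formula is
-- 𝓕₂ₘ = 𝓛ₘ 𝓕ₘ.

module Submission where

open import Algebra.Bundles using (CommutativeRing)
import Algebra.Definitions.RawSemiring as RawSemiringDefs
open import Data.Fin.Base using (Fin; zero; suc; toℕ; fromℕ; inject₁; punchIn; punchOut)
open import Data.Fin.Induction using (<-weakInduction)
open import Data.Fin.Properties
  using (_≟_; suc-injective; toℕ-inject₁; toℕ-fromℕ; toℕ-injective; toℕ<n;
         punchIn-punchOut; punchInᵢ≢i; punchIn-injective)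
import Data.Integer.Properties as ℤ
import Data.Nat.Properties as ℕ
open import Data.Nat.Tactic.RingSolver using (solve-∀)
open import Data.Product.Base using (_,_; ∃)
import Data.Rational.Properties as ℚ
import Data.Rational.Unnormalised.Base as ℚᵘ
import Data.Rational.Unnormalised.Properties as ℚᵘ
open import Data.Sum.Base using (_⊎_; inj₁; inj₂)
open import Data.Vec.Functional using (Vector; updateAt)
open import Data.Vec.Functional.Properties using (updateAt-updates; updateAt-minimal)
open import Function.Base using (_∘_; const)
open import Relation.Binary.PropositionalEquality as ≡ using (_≢_; refl; cong; cong₂)
open import Relation.Binary.Definitions using (tri<; tri≈; tri>)
open import Relation.Nullary.Decidable using (yes; no)
open import Relation.Nullary.Negation using (contradiction)

open import Defs
open import Data.Integer.Base as ℤ using (+_)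
open import Data.Nat.Base as ℕ using (ℕ; suc)
open import Data.Product.Base using (_×_)
open import Data.Rational.Base as ℚ using (ℚ)
open import Relation.Binary.PropositionalEquality.Core using (_≡_)

-- Positions of two adjacent columns after a column is deleted.

-- Deleting a column outside an adjacent pair leaves the pair adjacent, so a hypothesis about
-- neighbouring columns passes to the minors.
punchIn-adjacent : ∀ {n} (j : Fin (suc n)) (k : Fin (suc (suc n))) →
  k ≡ inject₁ j ⊎ k ≡ suc j ⊎
  ∃ λ (i : Fin n) → punchIn k (inject₁ i) ≡ inject₁ j × punchIn k (suc i) ≡ suc j
punchIn-adjacent zero zero = inj₁ refl
punchIn-adjacent zero (suc zero) = inj₂ (inj₁ refl)
punchIn-adjacent {suc n} zero (suc (suc k)) = inj₂ (inj₂ (zero , refl , refl))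
punchIn-adjacent (suc j) zero = inj₂ (inj₂ (j , refl , refl))
punchIn-adjacent {suc n} (suc j) (suc k) with punchIn-adjacent j k
... | inj₁ eq = inj₁ (cong suc eq)
... | inj₂ (inj₁ eq) = inj₂ (inj₁ (cong suc eq))
... | inj₂ (inj₂ (i , p , q)) = inj₂ (inj₂ (suc i , cong suc p , cong suc q))

-- Deleting one or the other member of an adjacent pair gives the same list of columns, except at
-- the place held by the surviving member.
punchIn-inject₁-suc : ∀ {n} (j l : Fin (suc n)) →
  punchIn (inject₁ j) l ≡ punchIn (suc j) l ⊎
  (punchIn (inject₁ j) l ≡ suc j × punchIn (suc j) l ≡ inject₁ j)
punchIn-inject₁-suc zero zero = inj₂ (refl , refl)
punchIn-inject₁-suc zero (suc l) = inj₁ refl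
punchIn-inject₁-suc (suc j) zero = inj₁ refl
punchIn-inject₁-suc {suc n} (suc j) (suc l) with punchIn-inject₁-suc j l
... | inj₁ eq = inj₁ (cong suc eq)
... | inj₂ (p , q) = inj₂ (cong suc p , cong suc q)

inject₁≢suc : ∀ {n} (j : Fin n) → inject₁ j ≢ suc j
inject₁≢suc j eq = ℕ.1+n≢n (≡.trans (≡.sym (cong toℕ eq)) (toℕ-inject₁ j))

-- Multilinearity, alternation and column operations for the Laplace determinant.

module DeterminantProperties {c ℓ} (R : CommutativeRing c ℓ) where

  open CommutativeRing R hiding (zero; ring)
    renaming (Carrier to A; refl to ≈-refl; sym to ≈-sym; trans to ≈-trans)
  open import Algebra.Properties.Ring (CommutativeRing.ring R) using (-1*x≈-x; -‿involutive)
  open import Algebra.Properties.Semiring.Sum semiring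
  open import Algebra.Solver.Ring.NaturalCoefficients.Default commutativeSemiring
    using (solve; _:=_; _:+_; _:*_; con)
  open import Algebra.Properties.Semiring.Exp semiring using (_^_; ^-congˡ)
  open import Algebra.Properties.CommutativeSemiring.Exp commutativeSemiring using (^-distrib-*)
  open import Relation.Binary.Reasoning.Setoid setoid
  open Determinant rawRing renaming (det to detᴿ; alternate to alternateᴿ)

  -1*-1≈1 : - 1# * - 1# ≈ 1#
  -1*-1≈1 = ≈-trans (-1*x≈-x (- 1#)) (-‿involutive 1#)

  x+-1*x≈0 : ∀ x → x + - 1# * x ≈ 0#
  x+-1*x≈0 x = ≈-trans (+-congˡ (-1*x≈-x x)) (-‿inverseʳ x)

  sum-zero : ∀ {n} (f : Vector A n) → (∀ i → f i ≈ 0#) → sum f ≈ 0#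
  sum-zero {n} f f≈0 = ≈-trans (sum-cong-≋ f≈0) (sum-replicate-zero n)

  -- This is the shape of a Laplace expansion with two equal adjacent columns: their terms cancel
  -- and all the others vanish.
  sum-adjacent-cancel : ∀ {n} (f : Vector A (suc n)) (j : Fin n) →
    f (inject₁ j) + f (suc j) ≈ 0# →
    (∀ k → k ≢ inject₁ j → k ≢ suc j → f k ≈ 0#) →
    sum f ≈ 0#
  sum-adjacent-cancel f zero cancel rest = begin
    f zero + (f (suc zero) + sum (λ k → f (suc (suc k)))) ≈⟨ +-assoc _ _ _ ⟨
    f zero + f (suc zero) + sum (λ k → f (suc (suc k)))
      ≈⟨ +-cong cancel (sum-zero _ λ k → rest (suc (suc k)) (λ ()) (λ ())) ⟩
    0# + 0#                                               ≈⟨ +-identityˡ 0# ⟩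
    0#                                                    ∎
  sum-adjacent-cancel f (suc j) cancel rest = begin
    f zero + sum (λ k → f (suc k))
      ≈⟨ +-cong (rest zero (λ ()) (λ ()))
           (sum-adjacent-cancel (λ k → f (suc k)) j cancel λ k k≢ k≢′ →
              rest (suc k) (λ { refl → k≢ refl }) (λ { refl → k≢′ refl })) ⟩
    0# + 0#                        ≈⟨ +-identityˡ 0# ⟩
    0#                             ∎

  det-cong : ∀ {n} {M N : Matrix A n} → (∀ i j → M i j ≈ N i j) → detᴿ M ≈ detᴿ N
  det-cong {ℕ.zero} M≈N = ≈-refl
  det-cong {suc n} M≈N = sum-cong-≋ λ j →
    *-congˡ {(- 1#) ^ toℕ j} (*-cong (M≈N zero j) (det-cong λ k l → M≈N (suc k) (punchIn j l)))

  private
    linear-at : ∀ s m p c d → s * ((m + c * p) * d) ≈ s * (m * d) + c * (s * (p * d))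
    linear-at = solve 5 (λ s m p c d →
      s :* ((m :+ c :* p) :* d) := s :* (m :* d) :+ c :* (s :* (p :* d))) ≈-refl

    linear-off : ∀ s m c d e → s * (m * (d + c * e)) ≈ s * (m * d) + c * (s * (m * e))
    linear-off = solve 5 (λ s m c d e →
      s :* (m :* (d :+ c :* e)) := s :* (m :* d) :+ c :* (s :* (m :* e))) ≈-refl

  -- Induction on the order. In the term of column `j` the entry splits and the three minors
  -- coincide; in every other term the entries coincide and the minor splits by induction.
  det-linear : ∀ {n} (M N P : Matrix A n) (j : Fin n) c →
    (∀ i → N i j ≈ M i j + c * P i j) →
    (∀ i k → k ≢ j → N i k ≈ M i k) →
    (∀ i k → k ≢ j → P i k ≈ M i k) →
    detᴿ N ≈ detᴿ M + c * detᴿ P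
  det-linear {suc n} M N P j c at-j N≈M P≈M = begin
    sum (term N)                                ≈⟨ sum-cong-≋ term-linear ⟩
    sum (λ k → term M k + c * term P k)         ≈⟨ ∑-distrib-+ (term M) (λ k → c * term P k) ⟩
    sum (term M) + sum (λ k → c * term P k)     ≈⟨ +-congˡ (*-distribˡ-sum c (term P)) ⟨
    sum (term M) + c * sum (term P)             ∎
    where
    term : Matrix A (suc n) → Vector A (suc n)
    term X k = (- 1#) ^ toℕ k * (X zero k * detᴿ (minor X zero k))

    term-linear : ∀ k → term N k ≈ term M k + c * term P k
    term-linear k with k ≟ j
    ... | yes refl = begin
      s * (N zero k * detᴿ (minor N zero k))
        ≈⟨ *-congˡ (*-cong (at-j zero) (det-cong λ i l → N≈M (suc i) _ (punchInᵢ≢i k l))) ⟩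
      s * ((M zero k + c * P zero k) * detᴿ (minor M zero k))
        ≈⟨ linear-at s _ _ c _ ⟩
      term M k + c * (s * (P zero k * detᴿ (minor M zero k)))
        ≈⟨ +-congˡ (*-congˡ (*-congˡ (*-congˡ (det-cong λ i l → P≈M (suc i) _ (punchInᵢ≢i k l))))) ⟨
      term M k + c * term P k ∎
      where s = (- 1#) ^ toℕ k
    ... | no k≢j = begin
      s * (N zero k * detᴿ (minor N zero k))
        ≈⟨ *-congˡ (*-cong (N≈M zero k k≢j)
             (det-linear (minor M zero k) (minor N zero k) (minor P zero k) j′ c
               (λ i → ≡.subst (λ l → N (suc i) l ≈ M (suc i) l + c * P (suc i) l) (≡.sym j′↦j) (at-j (suc i)))
               (λ i l l≢ → N≈M (suc i) _ (avoid l≢))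
               (λ i l l≢ → P≈M (suc i) _ (avoid l≢)))) ⟩
      s * (M zero k * (detᴿ (minor M zero k) + c * detᴿ (minor P zero k)))
        ≈⟨ linear-off s _ c _ _ ⟩
      term M k + c * (s * (M zero k * detᴿ (minor P zero k)))
        ≈⟨ +-congˡ (*-congˡ (*-congˡ (*-congʳ (P≈M zero k k≢j)))) ⟨
      term M k + c * term P k ∎
      where
      s = (- 1#) ^ toℕ k
      -- The position of column `j` in the minor without column `k`.
      j′ = punchOut k≢j
      j′↦j : punchIn k j′ ≡ j
      j′↦j = punchIn-punchOut k≢j
      avoid : ∀ {l} → l ≢ j′ → punchIn k l ≢ j
      avoid l≢ eq = l≢ (punchIn-injective k _ _ (≡.trans eq (≡.sym j′↦j)))

  -- A zero column equals itself minus itself, so linearity with all three matrices equal to `M`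
  -- gives `det M = det M - det M`.
  det-zeroColumn : ∀ {n} (M : Matrix A n) (j : Fin n) → (∀ i → M i j ≈ 0#) → detᴿ M ≈ 0#
  det-zeroColumn M j M≈0 = begin
    detᴿ M                  ≈⟨ det-linear M M M j (- 1#)
                                 (λ i → ≈-trans (M≈0 i) (≈-sym (x+-1*x≈0 (M i j))))
                                 (λ _ _ _ → ≈-refl) (λ _ _ _ → ≈-refl) ⟩
    detᴿ M + - 1# * detᴿ M  ≈⟨ x+-1*x≈0 (detᴿ M) ⟩
    0#                      ∎

  -- The terms of the two equal columns have equal entries, equal minors and opposite signs; every
  -- other minor again has two equal adjacent columns, and induction applies. Keeping the columns
  -- adjacent avoids counting transpositions.
  det-equalColumns : ∀ {n} (M : Matrix A (suc n)) (j : Fin n) →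
    (∀ i → M i (inject₁ j) ≈ M i (suc j)) → detᴿ M ≈ 0#
  det-equalColumns {suc n} M j eq = sum-adjacent-cancel _ j cancel rest
    where
    minors : ∀ k l → minor M zero (inject₁ j) k l ≈ minor M zero (suc j) k l
    minors k l with punchIn-inject₁-suc j l
    ... | inj₁ p = reflexive (cong (M (suc k)) p)
    ... | inj₂ (p , q) = begin
      M (suc k) (punchIn (inject₁ j) l) ≡⟨ cong (M (suc k)) p ⟩
      M (suc k) (suc j)                 ≈⟨ eq (suc k) ⟨
      M (suc k) (inject₁ j)             ≡⟨ cong (M (suc k)) q ⟨
      M (suc k) (punchIn (suc j) l)     ∎

    term : Fin (suc (suc n)) → A
    term k = (- 1#) ^ toℕ k * (M zero k * detᴿ (minor M zero k))

    cancel : term (inject₁ j) + term (suc j) ≈ 0#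
    cancel = begin
      (- 1#) ^ toℕ (inject₁ j) * (M zero (inject₁ j) * detᴿ (minor M zero (inject₁ j))) + term (suc j)
        ≈⟨ +-congʳ (*-cong (reflexive (cong ((- 1#) ^_) (toℕ-inject₁ j))) (*-cong (eq zero) (det-cong minors))) ⟩
      (- 1#) ^ toℕ j * (M zero (suc j) * detᴿ (minor M zero (suc j))) + term (suc j)
        -- The sign at `suc j` unfolds to `- 1#` times the sign at `j`, so the second term is `- 1#`
        -- times the first.
        ≈⟨ ≈-trans (+-congˡ (*-assoc _ _ _)) (x+-1*x≈0 _) ⟩
      0# ∎

    rest : ∀ k → k ≢ inject₁ j → k ≢ suc j → term k ≈ 0#
    rest k k≢ k≢′ with punchIn-adjacent j k
    ... | inj₁ p = contradiction p k≢
    ... | inj₂ (inj₁ p) = contradiction p k≢′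
    rest k _ _ | inj₂ (inj₂ (i , p , q)) = begin
      (- 1#) ^ toℕ k * (M zero k * detᴿ (minor M zero k))
        ≈⟨ *-congˡ (*-congˡ (det-equalColumns (minor M zero k) i λ l →
             ≈-trans (reflexive (cong (M (suc l)) p))
               (≈-trans (eq (suc l)) (reflexive (cong (M (suc l)) (≡.sym q)))))) ⟩
      (- 1#) ^ toℕ k * (M zero k * 0#) ≈⟨ *-congˡ (zeroʳ _) ⟩
      (- 1#) ^ toℕ k * 0#              ≈⟨ zeroʳ _ ⟩
      0#                               ∎

  -- By linearity the two determinants differ by `c * det P`, where `P` is `M` with column `suc j`
  -- overwritten by its left neighbour and so has two equal columns.
  det-addColumn : ∀ {n} (M N : Matrix A (suc n)) (j : Fin n) c →
    (∀ i → N i (suc j) ≈ M i (suc j) + c * M i (inject₁ j)) →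
    (∀ i k → k ≢ suc j → N i k ≈ M i k) →
    detᴿ N ≈ detᴿ M
  det-addColumn {n} M N j c at-suc N≈M = begin
    detᴿ N              ≈⟨ det-linear M N P (suc j) c
                             (λ i → ≈-trans (at-suc i) (+-congˡ (*-congˡ (reflexive (≡.sym (P-at i))))))
                             N≈M (λ i k k≢ → reflexive (P-off i k k≢)) ⟩
    detᴿ M + c * detᴿ P ≈⟨ +-congˡ (*-congˡ (det-equalColumns P j λ i →
                             reflexive (≡.trans (P-off i (inject₁ j) (inject₁≢suc j)) (≡.sym (P-at i))))) ⟩
    detᴿ M + c * 0#     ≈⟨ +-congˡ (zeroʳ c) ⟩
    detᴿ M + 0#         ≈⟨ +-identityʳ _ ⟩
    detᴿ M              ∎
    where
    P : Matrix A (suc n)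
    P i = updateAt (M i) (suc j) (const (M i (inject₁ j)))

    P-at : ∀ i → P i (suc j) ≡ M i (inject₁ j)
    P-at i = updateAt-updates (suc j) (M i)

    P-off : ∀ i k → k ≢ suc j → P i k ≡ M i k
    P-off i k = updateAt-minimal k (suc j) (M i)


  -- A column can so far only receive a multiple of its left neighbour. Shearing both matrices puts
  -- the required combination of columns `j` and `j + 1` into column `j + 1`; it is added to column
  -- `j + 2` from there, and the shears leave the determinants unchanged.
  det-addColumns : ∀ {n} (M N : Matrix A (suc (suc n))) (j : Fin n) c d →
    (∀ i → N i (suc (suc j)) ≈
           M i (suc (suc j)) + c * (M i (suc (inject₁ j)) + d * M i (inject₁ (inject₁ j)))) →
    (∀ i k → k ≢ suc (suc j) → N i k ≈ M i k) →
    detᴿ N ≈ detᴿ M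
  det-addColumns {n} M N j c d at-2+j N≈M = begin
    detᴿ N           ≈⟨ det-shear N ⟨
    detᴿ (shear N)   ≈⟨ det-addColumn (shear M) (shear N) (suc j) c shear-at shear-off ⟩
    detᴿ (shear M)   ≈⟨ det-shear M ⟩
    detᴿ M           ∎
    where
    shear : Matrix A (suc (suc n)) → Matrix A (suc (suc n))
    shear X i = updateAt (X i) (suc (inject₁ j)) (_+ d * X i (inject₁ (inject₁ j)))

    at-1+j : ∀ X i → shear X i (suc (inject₁ j)) ≡ X i (suc (inject₁ j)) + d * X i (inject₁ (inject₁ j))
    at-1+j X i = updateAt-updates (suc (inject₁ j)) (X i)

    off-1+j : ∀ X i k → k ≢ suc (inject₁ j) → shear X i k ≡ X i k
    off-1+j X i k = updateAt-minimal k (suc (inject₁ j)) (X i)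

    det-shear : ∀ X → detᴿ (shear X) ≈ detᴿ X
    det-shear X = det-addColumn X (shear X) (inject₁ j) d
      (λ i → reflexive (at-1+j X i)) (λ i k k≢ → reflexive (off-1+j X i k k≢))

    2+j≢1+j : suc (suc j) ≢ suc (inject₁ j)
    2+j≢1+j eq = inject₁≢suc j (suc-injective (≡.sym eq))

    j≢2+j : inject₁ (inject₁ j) ≢ suc (suc j)
    j≢2+j eq = ℕ.m≢1+n+m (toℕ j)
      (≡.trans (≡.sym (≡.trans (toℕ-inject₁ (inject₁ j)) (toℕ-inject₁ j))) (cong toℕ eq))

    shear-at : ∀ i → shear N i (suc (suc j)) ≈ shear M i (suc (suc j)) + c * shear M i (suc (inject₁ j))
    shear-at i = begin
      shear N i (suc (suc j)) ≡⟨ off-1+j N i _ 2+j≢1+j ⟩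
      N i (suc (suc j))       ≈⟨ at-2+j i ⟩
      M i (suc (suc j)) + c * (M i (suc (inject₁ j)) + d * M i (inject₁ (inject₁ j)))
        ≡⟨ cong₂ (λ x y → x + c * y) (off-1+j M i _ 2+j≢1+j) (at-1+j M i) ⟨
      shear M i (suc (suc j)) + c * shear M i (suc (inject₁ j)) ∎

    shear-off : ∀ i k → k ≢ suc (suc j) → shear N i k ≈ shear M i k
    shear-off i k k≢ with k ≟ suc (inject₁ j)
    ... | yes refl = begin
      shear N i k                           ≡⟨ at-1+j N i ⟩
      N i k + d * N i (inject₁ (inject₁ j)) ≈⟨ +-cong (N≈M i k k≢) (*-congˡ (N≈M i _ j≢2+j)) ⟩
      M i k + d * M i (inject₁ (inject₁ j)) ≡⟨ at-1+j M i ⟨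
      shear M i k                           ∎
    ... | no k≢1+j = begin
      shear N i k ≡⟨ off-1+j N i k k≢1+j ⟩
      N i k       ≈⟨ N≈M i k k≢ ⟩
      M i k       ≡⟨ off-1+j M i k k≢1+j ⟨
      shear M i k ∎

  -- Passing from M to N one column at a time, from the right, so that the two
  -- columns added at each step are still those of M.
  det-eliminate : ∀ {n} (M N : Matrix A (suc (suc n))) c d →
    (∀ i → N i zero ≈ M i zero) →
    (∀ i → N i (suc zero) ≈ M i (suc zero)) →
    (∀ i j → N i (suc (suc j)) ≈
             M i (suc (suc j)) + c * (M i (suc (inject₁ j)) + d * M i (inject₁ (inject₁ j)))) →
    detᴿ N ≈ detᴿ M
  det-eliminate {n} M N c d N≈M₀ N≈M₁ N≈M₂₊ = begin
    detᴿ N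
      -- The induction variable counts the columns after the first two that already come from `M`;
      -- at its last value `n` all columns do.
      ≈⟨ <-weakInduction (λ k → detᴿ N ≈ detᴿ (hybrid (2 ℕ.+ toℕ k))) base advance (fromℕ n) ⟩
    detᴿ (hybrid (2 ℕ.+ toℕ (fromℕ n))) ≡⟨ cong (λ k → detᴿ (hybrid (2 ℕ.+ k))) (toℕ-fromℕ n) ⟩
    detᴿ (hybrid (2 ℕ.+ n))           ≈⟨ det-cong (λ i j → reflexive (hybrid-< i (toℕ<n j))) ⟩
    detᴿ M                            ∎
    where
    hybrid : ℕ → Matrix A (suc (suc n))
    hybrid k i j with toℕ j ℕ.<? k
    ... | yes _ = M i j
    ... | no  _ = N i j

    hybrid-< : ∀ {k} i {j} → toℕ j ℕ.< k → hybrid k i j ≡ M i j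
    hybrid-< {k} i {j} j<k with toℕ j ℕ.<? k
    ... | yes _  = refl
    ... | no j≮k = contradiction j<k j≮k

    hybrid-≥ : ∀ {k} i {j} → k ℕ.≤ toℕ j → hybrid k i j ≡ N i j
    hybrid-≥ {k} i {j} k≤j with toℕ j ℕ.<? k
    ... | yes j<k = contradiction k≤j (ℕ.<⇒≱ j<k)
    ... | no _    = refl

    base : detᴿ N ≈ detᴿ (hybrid 2)
    base = det-cong {M = N} {hybrid 2} λ where
      i zero          → N≈M₀ i
      i (suc zero)    → N≈M₁ i
      i (suc (suc j)) → ≈-refl

    module _ (k : Fin n) where
      before = hybrid (2 ℕ.+ toℕ k)
      after  = hybrid (3 ℕ.+ toℕ k)

      changed : ∀ i → before i (suc (suc k)) ≈
        after i (suc (suc k)) + c * (after i (suc (inject₁ k)) + d * after i (inject₁ (inject₁ k)))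
      changed i = begin
        before i (suc (suc k)) ≡⟨ hybrid-≥ i ℕ.≤-refl ⟩
        N i (suc (suc k))      ≈⟨ N≈M₂₊ i k ⟩
        M i (suc (suc k)) + c * (M i (suc (inject₁ k)) + d * M i (inject₁ (inject₁ k)))
          ≡⟨ cong₂ (λ x y → x + c * y) (hybrid-< i ℕ.≤-refl)
               (cong₂ (λ x y → x + d * y) (hybrid-< i 1+k<) (hybrid-< i k<)) ⟨
        after i (suc (suc k)) + c * (after i (suc (inject₁ k)) + d * after i (inject₁ (inject₁ k))) ∎
        where
        1+k< : toℕ (suc (inject₁ k)) ℕ.< 3 ℕ.+ toℕ k
        1+k< rewrite toℕ-inject₁ k = ℕ.n≤1+n _
        k< : toℕ (inject₁ (inject₁ k)) ℕ.< 3 ℕ.+ toℕ k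
        k< rewrite toℕ-inject₁ (inject₁ k) | toℕ-inject₁ k = ℕ.m≤n+m _ 2

      unchanged : ∀ i j → j ≢ suc (suc k) → before i j ≈ after i j
      unchanged i j j≢ with ℕ.<-cmp (toℕ j) (2 ℕ.+ toℕ k)
      ... | tri< j< _ _ = reflexive (≡.trans (hybrid-< i j<) (≡.sym (hybrid-< i (ℕ.m<n⇒m<1+n j<))))
      ... | tri≈ _ j≡ _ = contradiction (toℕ-injective j≡) j≢
      ... | tri> _ _ j> = reflexive (≡.trans (hybrid-≥ i (ℕ.<⇒≤ j>)) (≡.sym (hybrid-≥ i j>)))

      advance : detᴿ N ≈ detᴿ (hybrid (2 ℕ.+ toℕ (inject₁ k))) → detᴿ N ≈ detᴿ after
      advance ih = begin
        detᴿ N                                  ≈⟨ ih ⟩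
        detᴿ (hybrid (2 ℕ.+ toℕ (inject₁ k)))   ≡⟨ cong (λ l → detᴿ (hybrid (2 ℕ.+ l))) (toℕ-inject₁ k) ⟩
        detᴿ before                             ≈⟨ det-addColumns after before k c d changed unchanged ⟩
        detᴿ after                              ∎

  -- A column followed by a scalar superdiagonal.

  diagonal : A → ℕ → ℕ → A
  diagonal x ℕ.zero  ℕ.zero  = x
  diagonal x ℕ.zero  (suc j) = 0#
  diagonal x (suc i) ℕ.zero  = 0#
  diagonal x (suc i) (suc j) = diagonal x i j

  restrict : (ℕ → ℕ → A) → (n : ℕ) → Matrix A n
  restrict f n i j = f (toℕ i) (toℕ j)

  bordered : A → (ℕ → A) → ℕ → ℕ → A
  bordered x w i ℕ.zero  = w i
  bordered x w i (suc j) = diagonal x i j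

  private
    bordered-base : ∀ w → 1# * (w * 1#) + 0# ≈ 1# * w
    bordered-base = solve 1 (λ w → con 1 :* (w :* con 1) :+ con 0 := con 1 :* w) ≈-refl

    bordered-step : ∀ e w x p v →
      1# * (w * 0#) + ((e * 1#) * (x * (p * v)) + 0#) ≈ e * x * p * v
    bordered-step = solve 5 (λ e w x p v →
      con 1 :* (w :* con 0) :+ ((e :* con 1) :* (x :* (p :* v)) :+ con 0) := e :* x :* p :* v) ≈-refl

  -- In the first row only `w 0` and `x` can be nonzero. The minor of `w 0` begins with a zero
  -- column; that of `x` has the same form with `w` shifted. Each step thus contributes a factor
  -- `- x`.
  det-bordered : ∀ x w n → detᴿ (restrict (bordered x w) (suc n)) ≈ (- 1# * x) ^ n * w n
  det-bordered x w ℕ.zero = bordered-base (w 0)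
  det-bordered x w (suc n) = begin
    detᴿ B
      ≈⟨ +-cong (*-congˡ (*-congˡ (det-zeroColumn (minor B zero zero) zero λ _ → ≈-refl)))
           (+-cong (*-congˡ (*-congˡ (≈-trans (det-cong minor₀₁) (det-bordered x (w ∘ suc) n))))
             (sum-zero {n} _ λ j → ≈-trans (*-congˡ (zeroˡ _)) (zeroʳ _))) ⟩
    1# * (w 0 * 0#) + ((- 1# * 1#) * (x * ((- 1# * x) ^ n * w (suc n))) + 0#)
      ≈⟨ bordered-step (- 1#) (w 0) x ((- 1# * x) ^ n) (w (suc n)) ⟩
    (- 1# * x) ^ suc n * w (suc n) ∎
    where
    B = restrict (bordered x w) (suc (suc n))

    minor₀₁ : ∀ k l → minor B zero (suc zero) k l ≈ restrict (bordered x (w ∘ suc)) (suc n) k l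
    minor₀₁ k zero    = ≈-refl
    minor₀₁ k (suc l) = ≈-refl

  -- The Toeplitz determinant of a sequence with the Fibonacci recurrence, over any commutative
  -- ring.

  module _ (α : ℕ → A) (recurrence : ∀ i → α (2 ℕ.+ i) ≈ α (1 ℕ.+ i) + α i) where

    private
      -- This is `α 1 - α 0 - (- α 1)`: the entry just below the main diagonal is `- α 1`.
      defect : A
      defect = α 1 + α 1 + - α 0

      T : ℕ → ℕ → A
      T = toeplitzEntry (alternateᴿ α) α

      reduced : ℕ → ℕ → A
      reduced i 0             = T i 0
      reduced i 1             = T i 1
      -- Column `j + 2` keeps only its entry in row `j + 1`, hence `suc j`.
      reduced i (suc (suc j)) = diagonal defect i (suc j)

      -- In this and the following identities `e` stands for `- 1#` and `s` for a power of it. The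
      -- solver is one for semirings, so `e * e = 1` and `x + e * x = 0` are applied outside it.
      top-left : ∀ e a b → (a + b) + e * (a + 1# * (1# * b)) ≈ (a + b) + e * (a + b)
      top-left = solve 3 (λ e a b →
        (a :+ b) :+ e :* (a :+ con 1 :* (con 1 :* b)) := (a :+ b) :+ e :* (a :+ b)) ≈-refl

      top : ∀ e a b → (a + b) + e * (a + 1# * b) ≈ (a + b) + e * (a + b)
      top = solve 3 (λ e a b → (a :+ b) :+ e :* (a :+ con 1 :* b) := (a :+ b) :+ e :* (a :+ b)) ≈-refl

      corner : ∀ e a b → a + e * (1# * b + 1# * ((e * 1#) * a)) ≈ a + (e * e) * a + e * b
      corner = solve 3 (λ e a b →
        a :+ e :* (con 1 :* b :+ con 1 :* ((e :* con 1) :* a)) := a :+ (e :* e) :* a :+ e :* b) ≈-refl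

      left : ∀ e s a b →
        s * b + e * ((e * s) * a + 1# * ((e * (e * s)) * (a + b))) ≈
        s * b + (e * e) * (s * a + e * (s * (a + b)))
      left = solve 4 (λ e s a b →
        s :* b :+ e :* ((e :* s) :* a :+ con 1 :* ((e :* (e :* s)) :* (a :+ b))) :=
        s :* b :+ (e :* e) :* (s :* a :+ e :* (s :* (a :+ b)))) ≈-refl

      left′ : ∀ e s a b →
        s * b + 1# * (s * a + e * (s * (a + b))) ≈ s * (a + b) + e * (s * (a + b))
      left′ = solve 4 (λ e s a b →
        s :* b :+ con 1 :* (s :* a :+ e :* (s :* (a :+ b))) :=
        s :* (a :+ b) :+ e :* (s :* (a :+ b))) ≈-refl

    -- Entries depend only on the difference of the indices, so row `0` and column `0` suffice. In
    -- row `0` the recurrence of `α` applies, with the corner separate because it reads `1# * α 0`.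
    -- Row `1` straddles the main diagonal and yields `defect`; lower rows obey the recurrence with
    -- alternating signs.
    reduced-recurrence : ∀ i j →
      diagonal defect i (suc j) ≈ T i (2 ℕ.+ j) + - 1# * (T i (1 ℕ.+ j) + 1# * T i j)
    reduced-recurrence ℕ.zero ℕ.zero = begin
      0#                                                ≈⟨ x+-1*x≈0 _ ⟨
      α 1 + α 0 + - 1# * (α 1 + α 0)                    ≈⟨ top-left (- 1#) (α 1) (α 0) ⟨
      α 1 + α 0 + - 1# * (α 1 + 1# * (1# * α 0))        ≈⟨ +-congʳ (recurrence 0) ⟨
      α 2 + - 1# * (α 1 + 1# * (1# * α 0))              ∎
    reduced-recurrence ℕ.zero (suc j) = begin
      0#                                                  ≈⟨ x+-1*x≈0 _ ⟨
      α (2 ℕ.+ j) + α (suc j) + - 1# * (α (2 ℕ.+ j) + α (suc j))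
        ≈⟨ top (- 1#) (α (2 ℕ.+ j)) (α (suc j)) ⟨
      α (2 ℕ.+ j) + α (suc j) + - 1# * (α (2 ℕ.+ j) + 1# * α (suc j))
        ≈⟨ +-congʳ (recurrence (suc j)) ⟨
      α (3 ℕ.+ j) + - 1# * (α (2 ℕ.+ j) + 1# * α (suc j)) ∎
    reduced-recurrence (suc ℕ.zero) ℕ.zero = begin
      α 1 + α 1 + - α 0
        ≈⟨ +-cong (+-congˡ (≈-trans (*-congʳ -1*-1≈1) (*-identityˡ _))) (-1*x≈-x _) ⟨
      α 1 + - 1# * - 1# * α 1 + - 1# * α 0
        ≈⟨ corner (- 1#) (α 1) (α 0) ⟨
      α 1 + - 1# * (1# * α 0 + 1# * ((- 1# * 1#) * α 1)) ∎
    reduced-recurrence (suc (suc i)) ℕ.zero = begin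
      0#
        ≈⟨ x+-1*x≈0 _ ⟨
      s * (a + b) + - 1# * (s * (a + b))
        ≈⟨ left′ (- 1#) s a b ⟨
      s * b + 1# * (s * a + - 1# * (s * (a + b)))
        ≈⟨ +-congˡ (*-congʳ -1*-1≈1) ⟨
      s * b + - 1# * - 1# * (s * a + - 1# * (s * (a + b)))
        ≈⟨ left (- 1#) s a b ⟨
      s * b + - 1# * ((- 1# * s) * a + 1# * ((- 1# * (- 1# * s)) * (a + b)))
        ≈⟨ +-congˡ (*-congˡ (+-congˡ (*-congˡ (*-congˡ (recurrence i))))) ⟨
      s * b + - 1# * ((- 1# * s) * a + 1# * ((- 1# * (- 1# * s)) * α (2 ℕ.+ i))) ∎
      where
      s = (- 1#) ^ i
      a = α (suc i)
      b = α i
    reduced-recurrence (suc i) (suc j) = reduced-recurrence i j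

    private
      collect : ∀ e a b p s u v →
        1# * ((1# * a) * (p * (s * u))) + ((e * 1#) * (b * (p * ((e * s) * v))) + 0#) ≈
        p * s * (a * u + (e * e) * (b * v))
      collect = solve 7 (λ e a b p s u v →
        con 1 :* ((con 1 :* a) :* (p :* (s :* u))) :+
          ((e :* con 1) :* (b :* (p :* ((e :* s) :* v))) :+ con 0) :=
        p :* s :* (a :* u :+ (e :* e) :* (b :* v))) ≈-refl

    -- The eliminated matrix has only `α 0` and `α 1` in its first row, and both minors have the
    -- bordered form. The order is `n + 2`, as elimination keeps two columns.
    det-toeplitz-alternate : ∀ n →
      detᴿ (toeplitz (alternateᴿ α) α (suc n)) ≈
      (α 1 + α 1 + - α 0) ^ n * (α 0 * α n + α 1 * α (suc n))
    det-toeplitz-alternate n = begin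
      detᴿ (toeplitz (alternateᴿ α) α (suc n))
        ≈⟨ det-eliminate (restrict T (2 ℕ.+ n)) E (- 1#) 1# (λ _ → ≈-refl) (λ _ → ≈-refl) columns ⟨
      detᴿ E
        ≈⟨ +-cong (*-congˡ (*-congˡ (≈-trans (det-cong minor₀₀) (det-bordered defect (alternateᴿ α) n))))
             (+-cong (*-congˡ (*-congˡ (≈-trans (det-cong minor₀₁) (det-bordered defect (alternateᴿ α ∘ suc) n))))
               (sum-zero {n} _ λ j → ≈-trans (*-congˡ (zeroˡ _)) (zeroʳ _))) ⟩
      1# * ((1# * α 0) * (p * (s * α n))) + ((- 1# * 1#) * (α 1 * (p * ((- 1# * s) * α (suc n)))) + 0#)
        ≈⟨ collect (- 1#) (α 0) (α 1) p s (α n) (α (suc n)) ⟩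
      p * s * (α 0 * α n + - 1# * - 1# * (α 1 * α (suc n)))
        ≈⟨ *-cong p*s (+-congˡ (≈-trans (*-congʳ -1*-1≈1) (*-identityˡ _))) ⟩
      defect ^ n * (α 0 * α n + α 1 * α (suc n)) ∎
      where
      E = restrict reduced (2 ℕ.+ n)
      p = (- 1# * defect) ^ n
      s = (- 1#) ^ n

      columns : ∀ i (j : Fin n) → E i (suc (suc j)) ≈
        restrict T (2 ℕ.+ n) i (suc (suc j)) +
        - 1# * (restrict T (2 ℕ.+ n) i (suc (inject₁ j)) + 1# * restrict T (2 ℕ.+ n) i (inject₁ (inject₁ j)))
      columns i j rewrite toℕ-inject₁ (inject₁ j) | toℕ-inject₁ j = reduced-recurrence (toℕ i) (toℕ j)

      -- Below its first row, column `1` of `T` repeats column `0`, by constancy along diagonals.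
      minor₀₀ : ∀ k l → minor E zero zero k l ≈ restrict (bordered defect (alternateᴿ α)) (suc n) k l
      minor₀₀ k zero    = ≈-refl
      minor₀₀ k (suc l) = ≈-refl

      minor₀₁ : ∀ k l → minor E zero (suc zero) k l ≈
        restrict (bordered defect (alternateᴿ α ∘ suc)) (suc n) k l
      minor₀₁ k zero    = ≈-refl
      minor₀₁ k (suc l) = ≈-refl

      -- The signs from the superdiagonal cancel those of the alternating column.
      p*s : p * s ≈ defect ^ n
      p*s = ≈-trans (≈-sym (^-distrib-* (- 1# * defect) (- 1#) n)) (^-congˡ n (begin
        - 1# * defect * - 1#   ≈⟨ *-comm _ _ ⟩
        - 1# * (- 1# * defect) ≈⟨ *-assoc _ _ _ ⟨
        - 1# * - 1# * defect   ≈⟨ *-congʳ -1*-1≈1 ⟩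
        1# * defect            ≈⟨ *-identityˡ _ ⟩
        defect                 ∎))

-- Natural numbers and integer powers in the rationals.

module ℚ-Determinant = DeterminantProperties ℚ.+-*-commutativeRing
open RawSemiringDefs ℚ.+-*-rawSemiring using (_^_)

-- Rational addition normalises its result, so the comparison is made between unnormalised
-- fractions, where it is an integer identity with denominators `1`.
↑-homo-+ : ∀ m n → ↑ (m ℕ.+ n) ≡ ↑ m ℚ.+ ↑ n
↑-homo-+ m n = ℚ.toℚᵘ-injective (ℚᵘ.≃-trans
  (ℚᵘ.*≡* (cong (ℤ._* + 1) (≡.sym (cong₂ ℤ._+_ (ℤ.*-identityʳ (+ m)) (ℤ.*-identityʳ (+ n))))))
  (ℚᵘ.≃-sym (ℚ.toℚᵘ-homo-+ (↑ m) (↑ n))))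

↑-homo-* : ∀ m n → ↑ (m ℕ.* n) ≡ ↑ m ℚ.* ↑ n
↑-homo-* m n = ℚ.toℚᵘ-injective (ℚᵘ.≃-trans
  (ℚᵘ.*≡* (cong (ℤ._* + 1) (ℤ.pos-* m n)))
  (ℚᵘ.≃-sym (ℚ.toℚᵘ-homo-* (↑ m) (↑ n))))

-- The nonzero instance depends on the base, which rules out plain `cong`; once the bases are
-- identified, the instances agree by irrelevance.
^ᶻ-cong : ∀ {p q} .{{_ : ℚ.NonZero p}} .{{_ : ℚ.NonZero q}} z → p ≡ q → p ^ᶻ z ≡ q ^ᶻ z
^ᶻ-cong z refl = refl

1^ᶻ[n-1] : ∀ n → ↑ 1 ^ᶻ (+ n ℤ.- + 1) ≡ ↑ 1
1^ᶻ[n-1] 0             = refl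
1^ᶻ[n-1] 1             = refl
1^ᶻ[n-1] (suc (suc n)) = ≡.trans (ℚ.*-identityˡ _) (1^ᶻ[n-1] (suc n))

-- Fibonacci and Lucas identities.

-- Induction on `m` moves one unit from `m` to `n`, so `n` stays general.
𝓕-+ : ∀ m n → 𝓕 (suc (m ℕ.+ n)) ≡ 𝓕 m ℕ.* 𝓕 n ℕ.+ 𝓕 (suc m) ℕ.* 𝓕 (suc n)
𝓕-+ ℕ.zero  n = ≡.sym (ℕ.+-identityʳ _)
𝓕-+ (suc m) n = begin
  𝓕 (2 ℕ.+ (m ℕ.+ n))                                            ≡⟨ cong (𝓕 ∘ suc) (ℕ.+-suc m n) ⟨
  𝓕 (suc (m ℕ.+ suc n))                                          ≡⟨ 𝓕-+ m (suc n) ⟩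
  𝓕 m ℕ.* 𝓕 (suc n) ℕ.+ 𝓕 (suc m) ℕ.* 𝓕 (2 ℕ.+ n)                ≡⟨ regroup (𝓕 m) (𝓕 (suc m)) (𝓕 n) (𝓕 (suc n)) ⟩
  𝓕 (suc m) ℕ.* 𝓕 n ℕ.+ 𝓕 (2 ℕ.+ m) ℕ.* 𝓕 (suc n)                ∎
  where
  open ≡.≡-Reasoning
  regroup : ∀ a b c d → a ℕ.* d ℕ.+ b ℕ.* (d ℕ.+ c) ≡ b ℕ.* c ℕ.+ (b ℕ.+ a) ℕ.* d
  regroup = solve-∀

𝓕-suc : ∀ m → 𝓕 (suc m) ≡ 𝓕 m ℕ.+ 𝓕-pred m
𝓕-suc ℕ.zero  = refl
𝓕-suc (suc m) = refl

-- Two-step induction, both sides having the same recurrence; `𝓕-suc` reduces everything to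
-- `𝓕-pred m` and `𝓕 m`.
𝓛≡𝓕+𝓕 : ∀ m → 𝓛 m ≡ 𝓕-pred m ℕ.+ 𝓕 (suc m)
𝓛≡𝓕+𝓕 0             = refl
𝓛≡𝓕+𝓕 1             = refl
𝓛≡𝓕+𝓕 (suc (suc m)) rewrite 𝓛≡𝓕+𝓕 (suc m) | 𝓛≡𝓕+𝓕 m | 𝓕-suc m = regroup (𝓕-pred m) (𝓕 m)
  where
  regroup : ∀ p a →
    (a ℕ.+ (a ℕ.+ p ℕ.+ a)) ℕ.+ (p ℕ.+ (a ℕ.+ p)) ≡ (a ℕ.+ p) ℕ.+ (a ℕ.+ p ℕ.+ a ℕ.+ (a ℕ.+ p))
  regroup = solve-∀

-- The subtraction-free form of `𝓛 m = 2 𝓕 (m + 1) - 𝓕 m`, which evaluates `defect`.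
𝓛+𝓕 : ∀ m → 𝓛 m ℕ.+ 𝓕 m ≡ 𝓕 (suc m) ℕ.+ 𝓕 (suc m)
𝓛+𝓕 m rewrite 𝓛≡𝓕+𝓕 m | 𝓕-suc m = regroup (𝓕-pred m) (𝓕 m)
  where
  regroup : ∀ p a → p ℕ.+ (a ℕ.+ p) ℕ.+ a ≡ a ℕ.+ p ℕ.+ (a ℕ.+ p)
  regroup = solve-∀

-- In the addition formula at `m` and `m + 1` both products contain `𝓕 (m + 1)`, and the cofactor is
-- `𝓛 (m + 1)`.
𝓕-double : ∀ m → 𝓕 (2 ℕ.* m) ≡ 𝓛 m ℕ.* 𝓕 m
𝓕-double ℕ.zero  = refl
𝓕-double (suc m) = begin
  𝓕 (suc (m ℕ.+ (suc m ℕ.+ 0)))                              ≡⟨ cong (λ k → 𝓕 (suc (m ℕ.+ k))) (ℕ.+-identityʳ (suc m)) ⟩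
  𝓕 (suc (m ℕ.+ suc m))                                      ≡⟨ 𝓕-+ m (suc m) ⟩
  𝓕 m ℕ.* 𝓕 (suc m) ℕ.+ 𝓕 (suc m) ℕ.* 𝓕 (2 ℕ.+ m)            ≡⟨ regroup (𝓕 m) (𝓕 (suc m)) (𝓕 (2 ℕ.+ m)) ⟩
  (𝓕 m ℕ.+ 𝓕 (2 ℕ.+ m)) ℕ.* 𝓕 (suc m)                        ≡⟨ cong (ℕ._* 𝓕 (suc m)) (𝓛≡𝓕+𝓕 (suc m)) ⟨
  𝓛 (suc m) ℕ.* 𝓕 (suc m)                                    ∎
  where
  open ≡.≡-Reasoning
  regroup : ∀ a b c → a ℕ.* b ℕ.+ b ℕ.* c ≡ (a ℕ.+ c) ℕ.* b
  regroup = solve-∀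

-- The determinant for shifted Fibonacci numbers.

module _ (m : ℕ) where

  open ≡.≡-Reasoning

  private
    instance
      _ = 𝓛-nonZero m

    α : ℕ → ℚ
    α i = ↑ 𝓕 (m ℕ.+ i)

    α-recurrence : ∀ i → α (2 ℕ.+ i) ≡ α (1 ℕ.+ i) ℚ.+ α i
    α-recurrence i rewrite ℕ.+-suc m (suc i) | ℕ.+-suc m i = ↑-homo-+ (𝓕 (suc (m ℕ.+ i))) (𝓕 (m ℕ.+ i))

    α-defect : α 1 ℚ.+ α 1 ℚ.+ ℚ.- α 0 ≡ ↑ 𝓛 m
    α-defect rewrite ℕ.+-suc m 0 | ℕ.+-identityʳ m = begin
      ↑ 𝓕 (suc m) ℚ.+ ↑ 𝓕 (suc m) ℚ.+ ℚ.- ↑ 𝓕 m  ≡⟨ cong (ℚ._+ ℚ.- ↑ 𝓕 m) (↑-homo-+ (𝓕 (suc m)) (𝓕 (suc m))) ⟨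
      ↑ (𝓕 (suc m) ℕ.+ 𝓕 (suc m)) ℚ.+ ℚ.- ↑ 𝓕 m  ≡⟨ cong (λ k → ↑ k ℚ.+ ℚ.- ↑ 𝓕 m) (𝓛+𝓕 m) ⟨
      ↑ (𝓛 m ℕ.+ 𝓕 m) ℚ.+ ℚ.- ↑ 𝓕 m              ≡⟨ cong (ℚ._+ ℚ.- ↑ 𝓕 m) (↑-homo-+ (𝓛 m) (𝓕 m)) ⟩
      ↑ 𝓛 m ℚ.+ ↑ 𝓕 m ℚ.+ ℚ.- ↑ 𝓕 m              ≡⟨ ℚ.+-assoc (↑ 𝓛 m) (↑ 𝓕 m) (ℚ.- ↑ 𝓕 m) ⟩
      ↑ 𝓛 m ℚ.+ (↑ 𝓕 m ℚ.+ ℚ.- ↑ 𝓕 m)            ≡⟨ cong (↑ 𝓛 m ℚ.+_) (ℚ.+-inverseʳ (↑ 𝓕 m)) ⟩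
      ↑ 𝓛 m ℚ.+ ↑ 0                              ≡⟨ ℚ.+-identityʳ (↑ 𝓛 m) ⟩
      ↑ 𝓛 m                                      ∎

    α-addition : ∀ n → α 0 ℚ.* α n ℚ.+ α 1 ℚ.* α (suc n) ≡ ↑ 𝓕 (2 ℕ.* m ℕ.+ suc n)
    α-addition n
      rewrite ℕ.+-suc m n | ℕ.+-suc m 0 | ℕ.+-identityʳ m | ℕ.+-suc (m ℕ.+ m) n | ℕ.+-assoc m m n = begin
      ↑ 𝓕 m ℚ.* ↑ 𝓕 (m ℕ.+ n) ℚ.+ ↑ 𝓕 (suc m) ℚ.* ↑ 𝓕 (suc (m ℕ.+ n))
        ≡⟨ cong₂ ℚ._+_ (↑-homo-* (𝓕 m) _) (↑-homo-* (𝓕 (suc m)) _) ⟨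
      ↑ (𝓕 m ℕ.* 𝓕 (m ℕ.+ n)) ℚ.+ ↑ (𝓕 (suc m) ℕ.* 𝓕 (suc (m ℕ.+ n)))
        ≡⟨ ↑-homo-+ (𝓕 m ℕ.* 𝓕 (m ℕ.+ n)) (𝓕 (suc m) ℕ.* 𝓕 (suc (m ℕ.+ n))) ⟨
      ↑ (𝓕 m ℕ.* 𝓕 (m ℕ.+ n) ℕ.+ 𝓕 (suc m) ℕ.* 𝓕 (suc (m ℕ.+ n)))
        ≡⟨ cong ↑_ (𝓕-+ m (m ℕ.+ n)) ⟨
      ↑ 𝓕 (suc (m ℕ.+ (m ℕ.+ n))) ∎

  det-toeplitz-𝓕 : ∀ n →
    det (toeplitz (alternate α) α n) ≡ ↑ 𝓛 m ^ᶻ (+ n ℤ.- + 1) ℚ.* ↑ 𝓕 (2 ℕ.* m ℕ.+ n)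
  det-toeplitz-𝓕 ℕ.zero = begin
    ↑ 1 ℚ.* (↑ 1 ℚ.* α 0 ℚ.* ↑ 1) ℚ.+ ↑ 0    ≡⟨ ℚ.+-identityʳ _ ⟩
    ↑ 1 ℚ.* (↑ 1 ℚ.* α 0 ℚ.* ↑ 1)            ≡⟨ ℚ.*-identityˡ _ ⟩
    ↑ 1 ℚ.* α 0 ℚ.* ↑ 1                      ≡⟨ ℚ.*-identityʳ _ ⟩
    -- Here the exponent is `-1`; inserting `1/ L * L` makes the doubling formula applicable.
    ↑ 1 ℚ.* α 0                              ≡⟨ cong (ℚ._* α 0) (ℚ.*-inverseˡ L) ⟨
    ℚ.1/ L ℚ.* L ℚ.* α 0                     ≡⟨ ℚ.*-assoc (ℚ.1/ L) L (α 0) ⟩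
    -- The power `L ^ᶻ -1` unfolds to `1/ L * 1`, which accounts for the factor `↑ 1`.
    ℚ.1/ L ℚ.* (L ℚ.* α 0)                   ≡⟨ cong₂ ℚ._*_ (≡.sym (ℚ.*-identityʳ (ℚ.1/ L))) double ⟩
    ℚ.1/ L ℚ.* ↑ 1 ℚ.* ↑ 𝓕 (2 ℕ.* m ℕ.+ 0)   ∎
    where
    L = ↑ 𝓛 m
    double : L ℚ.* α 0 ≡ ↑ 𝓕 (2 ℕ.* m ℕ.+ 0)
    double = begin
      L ℚ.* α 0                 ≡⟨ ↑-homo-* (𝓛 m) _ ⟨
      ↑ (𝓛 m ℕ.* 𝓕 (m ℕ.+ 0))   ≡⟨ cong (λ k → ↑ (𝓛 m ℕ.* 𝓕 k)) (ℕ.+-identityʳ m) ⟩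
      ↑ (𝓛 m ℕ.* 𝓕 m)           ≡⟨ cong ↑_ (𝓕-double m) ⟨
      ↑ 𝓕 (2 ℕ.* m)             ≡⟨ cong (λ k → ↑ 𝓕 k) (ℕ.+-identityʳ (2 ℕ.* m)) ⟨
      ↑ 𝓕 (2 ℕ.* m ℕ.+ 0)       ∎
  -- The exponent `+ suc n - + 1` computes to `+ n`.
  det-toeplitz-𝓕 (suc n) = ≡.trans
    (ℚ-Determinant.det-toeplitz-alternate α α-recurrence n)
    (cong₂ (λ x y → x ^ n ℚ.* y) α-defect (α-addition n))

corollary2 :
  (∀ (m n : ℕ) →
    let instance
          _ = 𝓛-nonZero m
          _ = 𝓕-pred+𝓕-suc-nonZero m
        α : ℕ → ℚ
        α i = ↑ 𝓕 (m ℕ.+ i)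
    in
    (det (toeplitz (alternate α) α n)
      ≡ ↑ 𝓛 m ^ᶻ (+ n ℤ.- + 1) ℚ.* ↑ 𝓕 (2 ℕ.* m ℕ.+ n))
    ×
    (↑ 𝓛 m ^ᶻ (+ n ℤ.- + 1) ℚ.* ↑ 𝓕 (2 ℕ.* m ℕ.+ n)
      ≡ ↑ (𝓕-pred m ℕ.+ 𝓕 (suc m)) ^ᶻ (+ n ℤ.- + 1) ℚ.* ↑ 𝓕 (2 ℕ.* m ℕ.+ n)))
  ×
  (∀ (n : ℕ) →
    let α : ℕ → ℚ
        α i = ↑ 𝓕 i
    in
    det (toeplitz (alternate α) α n) ≡ ↑ 2 ^ᶻ (+ n ℤ.- + 1) ℚ.* ↑ 𝓕 n)
  ×
  (∀ (n : ℕ) →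
    let α : ℕ → ℚ
        α i = ↑ 𝓕 (1 ℕ.+ i)
    in
    det (toeplitz (alternate α) α n) ≡ ↑ 𝓕 (n ℕ.+ 2))
corollary2 =
  (λ m n → det-toeplitz-𝓕 m n ,
    let instance
          _ = 𝓛-nonZero m
          _ = 𝓕-pred+𝓕-suc-nonZero m
    in cong (ℚ._* ↑ 𝓕 (2 ℕ.* m ℕ.+ n)) (^ᶻ-cong (+ n ℤ.- + 1) (cong ↑_ (𝓛≡𝓕+𝓕 m)))) ,
  -- At `m = 0` the base `𝓛 0` and all indices compute to the stated ones.
  det-toeplitz-𝓕 0 ,
  -- Since `𝓛 1` is `1`, the power is `1` for every exponent, including `-1`.
  λ n → ≡.trans (det-toeplitz-𝓕 1 n)
    (≡.trans (cong (ℚ._* ↑ 𝓕 (2 ℕ.+ n)) (1^ᶻ[n-1] n))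
      (≡.trans (ℚ.*-identityˡ _) (cong (λ k → ↑ 𝓕 k) (ℕ.+-comm 2 n))))
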